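{- Let $n\ge 4$ and $1\le k\le \frac n2$ be integers. Let $x,y$ be integers with $0\le x\le k-1$ and $0\le y\le k$. Then the number of $k$-subsets of $C_n=\mathbb{Z}/n\mathbb{Z}$ that have exactly $x$ incidences at distance $1$ and exactly $y$ incidences at distance $2$ is equal to $$\binom{n}{k}P(D_1=x,D_2=y)=\frac{n}{k-x}\sum_{a+b=k+y-2x}\binom{k-x}{a}\binom{x-1}{k-x-a-1}\binom{k-x}{b}\binom{n-2k+x-1}{k-x-b-1},$$ where the sum ranges over all pairs of nonnegative integers $(a,b)$ with $a+b=k+y-2x$.
   Context: For a $k$-subset $A$ (subset of cardinality $k$) of $C_n=\mathbb{Z}/n\mathbb{Z}$ with $0,1$-indicator function $f$, the number of incidences of $A$ at distance $j$ is the periodic autocorrelation value $\sigma_j(f)=\sum_{t\in C_n}f(t)f(t+j)$ (indices modulo $n$), i.e. the number of $t\in A$ with $t+j\in A$. $P$ is the uniform probability on the $\binom nk$ $k$-subsets of $C_n$, and $D_j$ is the random variable giving the number of incidences at distance $j$, for $1\le j\le \lfloor n/2\rfloor$. Convention for binomial coefficients with integer entries: $\binom{t}{t}=1$ for all integers $t$, including negative ones (e.g. $\binom{ -1}{ -1}=1$); for $s\ne t$, $\binom{t}{s}=0$ whenever $s<0$ or $s>t$ (so e.g. $\binom{ -1}{0}=0$); otherwise $\binom ts$ has its usual value. -}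

module Defs where

open import Data.Fin.Base using (Fin; toℕ)
open import Data.Fin.Subset using (Subset; inside; outside; ∣_∣)
open import Data.Bool.Base using (true; false)
open import Data.Integer.Base using (ℤ; +_; -[1+_])
open import Data.Integer.Properties as ℤ using ()
open import Data.List.Base using (List; []; _∷_; _++_; map; filter; length; upTo)
open import Data.Nat.Base using (ℕ; zero; suc; _+_; _*_; _∸_)
open import Data.Nat.Combinatorics using (_C_)
open import Data.Nat.DivMod using (_mod_)
open import Data.Nat.ListAction as List using ()
open import Data.Nat.Properties using (_≟_; +-0-commutativeMonoid)
open import Data.Product.Base using (_×_; _,_)
open import Data.Rational.Base as ℚ using (ℚ; 0ℚ)
open import Data.Vec.Base using ([]; _∷_; lookup)
open import Relation.Nullary.Decidable.Core using (yes; no)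
open import Algebra.Properties.CommutativeMonoid.Sum +-0-commutativeMonoid using (sum-syntax)
open import Relation.Unary using (Pred; Decidable)

-- ℤ/nℤ is represented by the residues Fin n, and a subset of it by Subset n.

_⊕_ : ∀ {n} → Fin n → ℕ → Fin n
_⊕_ {suc n} t j = (toℕ t + j) mod suc n

σ : ∀ {n} → ℕ → (Fin n → ℕ) → ℕ
σ {n} j f = ∑[ t < n ] (f t * f (t ⊕ j))

indicator : ∀ {n} → Subset n → Fin n → ℕ
indicator A t with lookup A t
... | true  = 1
... | false = 0

D : ∀ {n} → ℕ → Subset n → ℕ
D j A = σ j (indicator A)

-- Each subset occurs exactly once.
subsets : ∀ n → List (Subset n)
subsets zero    = [] ∷ []
subsets (suc n) = map (outside ∷_) (subsets n) ++ map (inside ∷_) (subsets n)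

kSubsets : ∀ n → ℕ → List (Subset n)
kSubsets n k = filter (λ A → ∣ A ∣ ≟ k) (subsets n)

count : ∀ {a p} {A : Set a} {E : Pred A p} → Decidable E → List A → ℕ
count E? Ω = length (filter E? Ω)

-- The uniform probability of the event E on the sample space listed by Ω;
-- the value on an empty sample space is junk.
uniform : ∀ {a p} {A : Set a} → List A → {E : Pred A p} → Decidable E → ℚ
uniform []         E? = 0ℚ
uniform Ω@(_ ∷ ω) E? = (+ count E? Ω) ℚ./ suc (length ω)

-- Unlike _C_, this has binom t t = 1 also for negative t.
binom : ℤ → ℤ → ℕ
binom t s with t ℤ.≟ s
binom t     s     | yes _ = 1
binom (+ t) (+ s) | no _  = t C s
binom _     _     | no _  = 0

-- The pairs (a , b) of natural numbers with a + b = m.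
pairsWithSum : ℤ → List (ℕ × ℕ)
pairsWithSum (+ m)    = map (λ a → a , m ∸ a) (upTo (suc m))
pairsWithSum -[1+ _ ] = []

sumOver : ∀ {a} {A : Set a} → List A → (A → ℕ) → ℕ
sumOver xs f = List.sum (map f xs)

module Submission where

-- A k-subset A with x incidences at distance 1 has k - x maximal runs of elements and as
-- many maximal gaps. A run of ℓ ≥ 2 elements yields ℓ - 2 incidences at distance 2, a gap
-- of length 1 yields one more, and nothing else contributes; hence D 2 A = y means that the
-- numbers a of singleton runs and b of singleton gaps satisfy a + b = k + y - 2x.
-- Counting pairs of a set and one of its k - x runs, and rotating the run to a fixed place,
-- gives (k - x) N = n M, where M counts linear words of alternating gaps and runs. These are
-- pairs of compositions of k and n - k into k - x parts, with a and b parts equal to 1, which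
-- yields the four binomial coefficients. The separation into two compositions is proved by
-- reading the word letter by letter, remembering only the last two letters.

open import Defs
open import Data.Bool.Base using (Bool; true; false; _∧_; not; if_then_else_)
open import Data.Fin.Base using (toℕ; zero; suc)
open import Data.Fin.Properties using (toℕ<n; toℕ-fromℕ<)
open import Data.Fin.Subset using (Subset; ∣_∣; inside; outside)
open import Data.Integer.Base as ℤ using (ℤ; +_; 1ℤ)
import Data.Integer.Properties as ℤ
import Data.Integer.Tactic.RingSolver as ℤ-Solver
open import Data.List.Base using (List; []; _∷_; map; length; filter; applyUpTo; upTo)
open import Data.List.Properties using (map-++; map-∘)
open import Data.Nat.Base hiding (_/_; _%_)
open import Data.Nat.Combinatorics using (_C_; nCk+nC[k+1]≡[n+1]C[k+1]; k>n⇒nCk≡0; nCn≡1)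
open import Data.Nat.DivMod using (_%_; m<n⇒m%n≡m; n%n≡0; m%n<n; %-distribˡ-+; [m+n]%n≡m%n)
import Data.Nat.ListAction as List
open import Data.Nat.ListAction.Properties using (sum-++)
open import Data.Nat.Properties
open import Data.Nat.Tactic.RingSolver using (solve-∀)
open import Data.Product.Base using (_×_; _,_)
open import Data.Rational.Base as ℚ using (_/_; toℚᵘ)
import Data.Rational.Properties as ℚ
open import Data.Rational.Unnormalised.Base as ℚᵘ using (mkℚᵘ; *≡*)
import Data.Rational.Unnormalised.Properties as ℚᵘ
open import Data.Vec.Base using ([]; _∷_; _∷ʳ_; lookup)
open import Function.Base using (_∘_)
open import Relation.Binary.PropositionalEquality
open import Relation.Nullary using (yes; no; does; contradiction)
open import Relation.Nullary.Decidable using (_×-dec_)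
open import Relation.Unary using (Pred; Decidable)
open import Algebra.Properties.CommutativeMonoid.Sum +-0-commutativeMonoid using (sum-syntax; sum-cong-≗; ∑-distrib-+)

-- Sums over lists

+-interchange : ∀ p q r s → p + q + (r + s) ≡ p + r + (q + s)
+-interchange = solve-∀

sumOver-cong : ∀ {a} {A : Set a} (xs : List A) {f g : A → ℕ} → (∀ z → f z ≡ g z) → sumOver xs f ≡ sumOver xs g
sumOver-cong []       eq = refl
sumOver-cong (z ∷ xs) eq = cong₂ _+_ (eq z) (sumOver-cong xs eq)

sumOver-zero : ∀ {a} {A : Set a} (xs : List A) {f : A → ℕ} → (∀ z → f z ≡ 0) → sumOver xs f ≡ 0
sumOver-zero []       eq = refl
sumOver-zero (z ∷ xs) eq = cong₂ _+_ (eq z) (sumOver-zero xs eq)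

sumOver-+ : ∀ {a} {A : Set a} (xs : List A) (f g : A → ℕ) →
            sumOver xs (λ z → f z + g z) ≡ sumOver xs f + sumOver xs g
sumOver-+ []       f g = refl
sumOver-+ (z ∷ xs) f g = trans (cong (_+_ (f z + g z)) (sumOver-+ xs f g)) (+-interchange (f z) (g z) _ _)

sumOver-*ˡ : ∀ {a} {A : Set a} (xs : List A) c (f : A → ℕ) → sumOver xs (λ z → c * f z) ≡ c * sumOver xs f
sumOver-*ˡ []       c f = sym (*-zeroʳ c)
sumOver-*ˡ (z ∷ xs) c f = trans (cong (_+_ (c * f z)) (sumOver-*ˡ xs c f)) (sym (*-distribˡ-+ c (f z) _))

sumOver-comm : ∀ {a b} {A : Set a} {B : Set b} (xs : List A) (ys : List B) (f : A → B → ℕ) →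
               sumOver xs (λ z → sumOver ys (f z)) ≡ sumOver ys (λ w → sumOver xs (λ z → f z w))
sumOver-comm []       ys f = sym (sumOver-zero ys (λ _ → refl))
sumOver-comm (z ∷ xs) ys f = trans (cong (_+_ (sumOver ys (f z))) (sumOver-comm xs ys f)) (sym (sumOver-+ ys (f z) _))

sumOver-subsets-suc : ∀ n (F : Subset (suc n) → ℕ) → sumOver (subsets (suc n)) F ≡
                      sumOver (subsets n) (F ∘ (outside ∷_)) + sumOver (subsets n) (F ∘ (inside ∷_))
sumOver-subsets-suc n F
  rewrite map-++ F (map (outside ∷_) (subsets n)) (map (inside ∷_) (subsets n))
        | sum-++ (map F (map (outside ∷_) (subsets n))) (map F (map (inside ∷_) (subsets n)))
        | map-∘ {g = F} {f = outside ∷_} (subsets n)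
        | map-∘ {g = F} {f = inside ∷_} (subsets n) = refl

-- Indicators

bit : Bool → ℕ
bit b = if b then 1 else 0

δ : ℕ → ℕ → ℕ
δ m n = bit (m ≡ᵇ n)

δ-refl : ∀ m → δ m m ≡ 1
δ-refl zero    = refl
δ-refl (suc m) = δ-refl m

δ-≢ : ∀ {m n} → m ≢ n → δ m n ≡ 0
δ-≢ {zero}  {zero}  m≢n = contradiction refl m≢n
δ-≢ {zero}  {suc n} m≢n = refl
δ-≢ {suc m} {zero}  m≢n = refl
δ-≢ {suc m} {suc n} m≢n = δ-≢ (m≢n ∘ cong suc)

δ-cong-⇔ : ∀ {m n i j} → (m ≡ n → i ≡ j) → (i ≡ j → m ≡ n) → δ m n ≡ δ i j
δ-cong-⇔ {m} {n} {i} {j} to from with m ≟ n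
... | yes refl with to refl
...   | refl = trans (δ-refl m) (sym (δ-refl i))
δ-cong-⇔ to from | no m≢n = trans (δ-≢ m≢n) (sym (δ-≢ (m≢n ∘ from)))

-- On generating functions this is multiplication by the variable. It records that one unit of a
-- statistic has been used up.
delay : (ℕ → ℕ) → ℕ → ℕ
delay f zero    = 0
delay f (suc n) = f n

-- Block compositions

-- Compositions of `n` into `d` positive parts: the first part equals 1 and is dropped, or it is
-- lowered by 1.
compositions : ℕ → ℕ → ℕ
compositions zero    zero    = 1
compositions zero    (suc d) = 0
compositions (suc n) zero    = 0
compositions (suc n) (suc d) = compositions n d + compositions n (suc d)

-- The number of sequences of r arbitrary blocks, exactly a of them singletons,
-- and e further blocks of length at least 2, with total length x + r + e.
blocks : ℕ → ℕ → ℕ → ℕ → ℕ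
blocks x e zero    zero    = compositions x e
blocks x e zero    (suc a) = 0
blocks x e (suc r) a       = delay (blocks x e r) a + blocks x (suc e) r a

-- One of the long blocks has length 2 and is dropped, or it is longer and loses a letter.
blocks-suc : ∀ x e r a → blocks (suc x) (suc e) r a ≡ blocks x e r a + blocks x (suc e) r a
blocks-suc x e zero    zero    = refl
blocks-suc x e zero    (suc a) = refl
blocks-suc x e (suc r) zero    = blocks-suc x (suc e) r 0
blocks-suc x e (suc r) (suc a) = trans (cong₂ _+_ (blocks-suc x e r a) (blocks-suc x (suc e) r (suc a)))
  (+-interchange (blocks x e r a) _ _ _)

-- The first argument is the total length minus the number of blocks, and a long block contributes
-- at least 1 to it.
blocks-zero : ∀ e r a → blocks 0 (suc e) r a ≡ 0
blocks-zero e zero    zero    = refl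
blocks-zero e zero    (suc a) = refl
blocks-zero e (suc r) zero    = blocks-zero (suc e) r 0
blocks-zero e (suc r) (suc a) = cong₂ _+_ (blocks-zero e r a) (blocks-zero (suc e) r (suc a))

blocks-none : ∀ x a → blocks (suc x) 0 0 a ≡ 0
blocks-none x zero    = refl
blocks-none x (suc a) = refl

blocks-one : ∀ a → blocks 0 0 1 a ≡ δ 1 a
blocks-one zero          = refl
blocks-one (suc zero)    = refl
blocks-one (suc (suc a)) = refl

compositions-suc : ∀ n d → compositions (suc n) (suc d) ≡ n C d
compositions-suc zero    zero          = refl
compositions-suc zero    (suc d)       = refl
compositions-suc (suc n) zero          = compositions-suc n 0
compositions-suc (suc n) (suc d)       =
  trans (cong₂ _+_ (compositions-suc n d) (compositions-suc n (suc d))) (nCk+nC[k+1]≡[n+1]C[k+1] n d)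

-- Choose which `a` of the `r` blocks are singletons. The others are long, and removing one letter
-- from every long block leaves a composition of `x`.
blocks≡C*compositions : ∀ x e r a → blocks x e r a ≡ (r C a) * compositions x (e + (r ∸ a))
blocks≡C*compositions x e zero    zero    rewrite +-identityʳ e = sym (+-identityʳ _)
blocks≡C*compositions x e zero    (suc a) = refl
blocks≡C*compositions x e (suc r) zero    =
  trans (blocks≡C*compositions x (suc e) r 0) (cong (λ d → 1 * compositions x d) (sym (+-suc e r)))
blocks≡C*compositions x e (suc r) (suc a) = begin
  blocks x e r a + blocks x (suc e) r (suc a)
    ≡⟨ cong₂ _+_ (blocks≡C*compositions x e r a) (blocks≡C*compositions x (suc e) r (suc a)) ⟩
  (r C a) * compositions x (e + (r ∸ a)) + (r C suc a) * compositions x (suc e + (r ∸ suc a))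
    ≡⟨ cong (_+_ ((r C a) * compositions x (e + (r ∸ a)))) same-parts ⟩
  (r C a) * compositions x (e + (r ∸ a)) + (r C suc a) * compositions x (e + (r ∸ a))
    ≡⟨ *-distribʳ-+ (compositions x (e + (r ∸ a))) (r C a) (r C suc a) ⟨
  ((r C a) + (r C suc a)) * compositions x (e + (r ∸ a))
    ≡⟨ cong (_* compositions x (e + (r ∸ a))) (nCk+nC[k+1]≡[n+1]C[k+1] r a) ⟩
  (suc r C suc a) * compositions x (e + (r ∸ a)) ∎
  where
  open ≡-Reasoning
  same-parts : (r C suc a) * compositions x (suc e + (r ∸ suc a)) ≡ (r C suc a) * compositions x (e + (r ∸ a))
  same-parts with a <? r
  ... | yes a<r = cong (λ d → (r C suc a) * compositions x d)
                    (trans (sym (+-suc e _)) (cong (_+_ e) (sym (+-∸-assoc 1 a<r))))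
  -- Here `r ∸ suc a` is truncated and the numbers of parts differ, but the factor `r C suc a` is 0.
  ... | no  a≮r rewrite k>n⇒nCk≡0 (s≤s (≮⇒≥ a≮r)) = refl

-- Statistics of words

-- The word u is read after the letters p, q, and the virtual letters 0, 1 follow its end:
-- they are the first two letters of the cyclic word 0 1 u, so that every run is closed.
one-pairs zero-pairs starts lone-ones lone-zeros gapped-pairs : ∀ {n} → Bool → Bool → Subset n → ℕ
one-pairs p q []      = 0
one-pairs p q (c ∷ u) = bit (q ∧ c) + one-pairs q c u
zero-pairs p q []      = bit (not q)
zero-pairs p q (c ∷ u) = bit (not q ∧ not c) + zero-pairs q c u
starts p q []      = 0
starts p q (c ∷ u) = bit (not q ∧ c) + starts q c u
lone-ones p q []      = bit (not p ∧ q)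
lone-ones p q (c ∷ u) = bit (not p ∧ q ∧ not c) + lone-ones q c u
lone-zeros p q []      = bit q
lone-zeros p q (c ∷ u) = bit (p ∧ not q ∧ c) + lone-zeros q c u
gapped-pairs p q []      = bit q
gapped-pairs p q (c ∷ u) = bit (p ∧ c) + gapped-pairs q c u

tally : ∀ {n} → Bool → Bool → ℕ → ℕ → ℕ → ℕ → ℕ → Subset n → ℕ
tally p q x w r a b u = δ (one-pairs p q u) x * (δ (zero-pairs p q u) w * (δ (starts p q u) r *
                        (δ (lone-ones p q u) a * δ (lone-zeros p q u) b)))

words : Bool → Bool → ℕ → ℕ → ℕ → ℕ → ℕ → ℕ → ℕ
words p q n x w r a b = sumOver (subsets n) (tally p q x w r a b)

-- Every 1 of `u` is preceded by a 1 or by a 0.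
one-pairs+starts : ∀ {n} p q (u : Subset n) → one-pairs p q u + starts p q u ≡ ∣ u ∣
one-pairs+starts p q     []          = refl
one-pairs+starts p true  (true ∷ u)  = cong suc (one-pairs+starts true true u)
one-pairs+starts p false (true ∷ u)  = trans (+-suc _ _) (cong suc (one-pairs+starts false true u))
one-pairs+starts p true  (false ∷ u) = one-pairs+starts true false u
one-pairs+starts p false (false ∷ u) = one-pairs+starts false false u

-- The word `q`, `u` followed by the virtual 0 has `n + 1` adjacent pairs, each of them 11, 00, 01
-- or 10. As it ends in 0, the pairs 10 outnumber the pairs 01 by `bit q`.
length-identity : ∀ {n} p q (u : Subset n) →
  one-pairs p q u + zero-pairs p q u + (starts p q u + starts p q u) ≡ n + bit (not q)
length-identity p true  []          = refl
length-identity p false []          = refl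
length-identity p true  (true ∷ u)  = cong suc (length-identity true true u)
length-identity p false (true ∷ u)  = trans (rearrange (one-pairs false true u + zero-pairs false true u) (starts false true u))
  (trans (cong (_+_ 2) (length-identity false true u)) (shift _))
  where
  rearrange : ∀ z s → z + (suc s + suc s) ≡ 2 + (z + (s + s))
  rearrange = solve-∀
  shift : ∀ n → 2 + (n + 0) ≡ suc n + 1
  shift = solve-∀
length-identity p true  (false ∷ u) = trans (length-identity true false u) (shift _)
  where
  shift : ∀ n → n + 1 ≡ suc n + 0
  shift = solve-∀
length-identity p false (false ∷ u) = trans (rearrange (one-pairs false false u) _ _) (cong suc (length-identity false false u))
  where
  rearrange : ∀ e z s → e + suc z + s ≡ suc (e + z + s)
  rearrange = solve-∀

-- A run of ℓ ≥ 2 ones contains ℓ - 2 pairs of ones at distance 2, and a lone zero adds one;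
-- bit (not p ∧ q) is the correction for a run whose only letter so far is q.
gapped-identity : ∀ {n} p q (u : Subset n) →
  gapped-pairs p q u + bit (not p ∧ q) + (starts p q u + starts p q u) ≡ ∣ u ∣ + lone-ones p q u + lone-zeros p q u
gapped-identity true  true  []          = refl
gapped-identity true  false []          = refl
gapped-identity false true  []          = refl
gapped-identity false false []          = refl
gapped-identity true  true  (true ∷ u)  = cong suc (gapped-identity true true u)
gapped-identity true  true  (false ∷ u) = gapped-identity true false u
gapped-identity false true  (true ∷ u)  = trans (rearrange (gapped-pairs true true u) _) (cong suc (gapped-identity true true u))
  where
  rearrange : ∀ g s → g + 1 + s ≡ suc (g + 0 + s)
  rearrange = solve-∀
gapped-identity false true  (false ∷ u) = trans (rearrange (gapped-pairs true false u) _)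
  (trans (cong suc (gapped-identity true false u)) (shift ∣ u ∣ _ _))
  where
  rearrange : ∀ g s → g + 1 + s ≡ suc (g + 0 + s)
  rearrange = solve-∀
  shift : ∀ m a b → suc (m + a + b) ≡ m + suc a + b
  shift = solve-∀
gapped-identity true  false (true ∷ u)  = trans (rearrange (gapped-pairs false true u) (starts false true u))
  (trans (cong (_+_ 2) (gapped-identity false true u)) (shift ∣ u ∣ _ _))
  where
  rearrange : ∀ g s → suc g + 0 + (suc s + suc s) ≡ 2 + (g + 1 + (s + s))
  rearrange = solve-∀
  shift : ∀ m a b → 2 + (m + a + b) ≡ suc m + a + suc b
  shift = solve-∀
gapped-identity true  false (false ∷ u) = gapped-identity false false u
gapped-identity false false (true ∷ u)  = trans (rearrange (gapped-pairs false true u) (starts false true u))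
  (cong suc (gapped-identity false true u))
  where
  rearrange : ∀ g s → g + 0 + (suc s + suc s) ≡ suc (g + 1 + (s + s))
  rearrange = solve-∀
gapped-identity false false (false ∷ u) = gapped-identity false false u

-- Counting words letter by letter

module _ (n : ℕ) where

  private
    *-vanish : ∀ m {k} → k ≡ 0 → m * k ≡ 0
    *-vanish m refl = *-zeroʳ m

  -- Split by the next letter: after 01, a 0 completes a lone one and a 1 makes a pair of ones. Each
  -- event lowers what is left of its statistic by 1, which is the `delay`. The other three states
  -- are treated alike.
  words-01 : ∀ x w r a b → words false true (suc n) x w r a b ≡
    delay (λ a → words true false n x w r a b) a + delay (λ x → words true true n x w r a b) x
  words-01 x w r a b = trans (sumOver-subsets-suc n _) (cong₂ _+_ (on-0 a) (on-1 x))
    where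
    on-0 : ∀ a → sumOver (subsets n) (λ u → tally false true x w r a b (false ∷ u)) ≡
           delay (λ a → words true false n x w r a b) a
    on-0 zero    = sumOver-zero (subsets n) λ u → *-vanish (δ (one-pairs true false u) x)
      (*-vanish (δ (zero-pairs true false u) w) (*-zeroʳ (δ (starts true false u) r)))
    on-0 (suc a) = refl
    on-1 : ∀ x → sumOver (subsets n) (λ u → tally false true x w r a b (true ∷ u)) ≡
           delay (λ x → words true true n x w r a b) x
    on-1 zero    = sumOver-zero (subsets n) λ u → refl
    on-1 (suc x) = refl

  words-11 : ∀ x w r a b → words true true (suc n) x w r a b ≡
    words true false n x w r a b + delay (λ x → words true true n x w r a b) x
  words-11 x w r a b = trans (sumOver-subsets-suc n _) (cong (_+_ (words true false n x w r a b)) (on-1 x))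
    where
    on-1 : ∀ x → sumOver (subsets n) (λ u → tally true true x w r a b (true ∷ u)) ≡
           delay (λ x → words true true n x w r a b) x
    on-1 zero    = sumOver-zero (subsets n) λ u → refl
    on-1 (suc x) = refl

  words-10 : ∀ x w r a b → words true false (suc n) x w r a b ≡
    delay (λ w → words false false n x w r a b) w + delay (λ r → delay (λ b → words false true n x w r a b) b) r
  words-10 x w r a b = trans (sumOver-subsets-suc n _) (cong₂ _+_ (on-0 w) (on-1 r b))
    where
    on-0 : ∀ w → sumOver (subsets n) (λ u → tally true false x w r a b (false ∷ u)) ≡
           delay (λ w → words false false n x w r a b) w
    on-0 zero    = sumOver-zero (subsets n) λ u → *-zeroʳ (δ (one-pairs false false u) x)
    on-0 (suc w) = refl
    on-1 : ∀ r b → sumOver (subsets n) (λ u → tally true false x w r a b (true ∷ u)) ≡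
           delay (λ r → delay (λ b → words false true n x w r a b) b) r
    on-1 zero    b       = sumOver-zero (subsets n) λ u →
      *-vanish (δ (one-pairs false true u) x) (*-zeroʳ (δ (zero-pairs false true u) w))
    on-1 (suc r) zero    = sumOver-zero (subsets n) λ u →
      *-vanish (δ (one-pairs false true u) x) (*-vanish (δ (zero-pairs false true u) w)
        (*-vanish (δ (starts false true u) r) (*-zeroʳ (δ (lone-ones false true u) a))))
    on-1 (suc r) (suc b) = refl

  words-00 : ∀ x w r a b → words false false (suc n) x w r a b ≡
    delay (λ w → words false false n x w r a b) w + delay (λ r → words false true n x w r a b) r
  words-00 x w r a b = trans (sumOver-subsets-suc n _) (cong₂ _+_ (on-0 w) (on-1 r))
    where
    on-0 : ∀ w → sumOver (subsets n) (λ u → tally false false x w r a b (false ∷ u)) ≡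
           delay (λ w → words false false n x w r a b) w
    on-0 zero    = sumOver-zero (subsets n) λ u → *-zeroʳ (δ (one-pairs false false u) x)
    on-0 (suc w) = refl
    on-1 : ∀ r → sumOver (subsets n) (λ u → tally false false x w r a b (true ∷ u)) ≡
           delay (λ r → words false true n x w r a b) r
    on-1 zero    = sumOver-zero (subsets n) λ u →
      *-vanish (δ (one-pairs false true u) x) (*-zeroʳ (δ (zero-pairs false true u) w))
    on-1 (suc r) = refl

-- The equation on `n` is the one that `length-identity` forces on the statistics. After 01 there
-- are `suc r` runs and `suc r` gaps to complete, the last gap being closed by the virtual letters;
-- after 10 or 00 only `r` runs remain. After 11 or 00 the open block is already long, and the pair
-- just read is put back into its excess: hence the second argument 1 together with `suc x` or
-- `suc w`. With these forms, reading a letter matches the recursions of `blocks`.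
words-01≡ : ∀ n x w r a b → n ≡ x + w + (r + r) →
            words false true n x w r a b ≡ blocks x 0 (suc r) a * blocks w 0 (suc r) b
words-11≡ : ∀ n x w r a b → n ≡ x + w + (r + r) →
            words true true n x w r a b ≡ blocks (suc x) 1 r a * blocks w 0 (suc r) b
words-10≡ : ∀ n x w r a b → suc n ≡ x + w + (r + r) →
            words true false n x w r a b ≡ blocks x 0 r a * blocks w 0 (suc r) b
words-00≡ : ∀ n x w r a b → suc n ≡ x + w + (r + r) →
            words false false n x w r a b ≡ blocks x 0 r a * blocks (suc w) 1 r b

words-01≡ zero zero zero zero a b eq
  rewrite blocks-one a | blocks-one b = normalise (δ 1 a * δ 1 b)
  where
  normalise : ∀ m → 1 * (1 * (1 * m)) + 0 ≡ m
  normalise = solve-∀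
words-01≡ (suc n) x w r a b eq = begin
  words false true (suc n) x w r a b
    ≡⟨ words-01 n x w r a b ⟩
  delay (λ a → words true false n x w r a b) a + delay (λ x → words true true n x w r a b) x
    ≡⟨ cong₂ _+_ (on-0 a) (on-1 x eq) ⟩
  delay (blocks x 0 r) a * W + blocks x 1 r a * W
    ≡⟨ *-distribʳ-+ W (delay (blocks x 0 r) a) _ ⟨
  blocks x 0 (suc r) a * W ∎
  where
  open ≡-Reasoning
  W = blocks w 0 (suc r) b
  on-0 : ∀ a → delay (λ a → words true false n x w r a b) a ≡ delay (blocks x 0 r) a * W
  on-0 zero    = refl
  on-0 (suc a) = words-10≡ n x w r a b eq
  on-1 : ∀ x → suc n ≡ x + w + (r + r) → delay (λ x → words true true n x w r a b) x ≡ blocks x 1 r a * W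
  -- No pair of ones is left, so the open run cannot become long.
  on-1 zero    eq rewrite blocks-zero 0 r a = refl
  on-1 (suc x) eq = words-11≡ n x w r a b (suc-injective eq)

words-11≡ zero zero zero zero zero          b eq rewrite blocks-one b = normalise (δ 1 b)
  where
  normalise : ∀ m → 1 * (1 * (1 * (1 * m))) + 0 ≡ 1 * m
  normalise = solve-∀
words-11≡ zero zero zero zero (suc a)       b eq = refl
words-11≡ (suc n) x w r a b eq = begin
  words true true (suc n) x w r a b
    ≡⟨ words-11 n x w r a b ⟩
  words true false n x w r a b + delay (λ x → words true true n x w r a b) x
    ≡⟨ cong₂ _+_ (words-10≡ n x w r a b eq) (on-1 x eq) ⟩
  blocks x 0 r a * W + blocks x 1 r a * W
    ≡⟨ *-distribʳ-+ W (blocks x 0 r a) _ ⟨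
  (blocks x 0 r a + blocks x 1 r a) * W
    ≡⟨ cong (_* W) (blocks-suc x 0 r a) ⟨
  blocks (suc x) 1 r a * W ∎
  where
  open ≡-Reasoning
  W = blocks w 0 (suc r) b
  on-1 : ∀ x → suc n ≡ x + w + (r + r) → delay (λ x → words true true n x w r a b) x ≡ blocks x 1 r a * W
  on-1 zero    eq rewrite blocks-zero 0 r a = refl
  on-1 (suc x) eq = words-11≡ n x w r a b (suc-injective eq)

-- The equation leaves one pair to be shared between `x` and `w`. The final 0 and the virtual 0 form
-- a pair of zeros, so the case `x = 1` is empty on both sides.
words-10≡ zero (suc zero) zero zero a b eq rewrite blocks-none 0 a = refl
words-10≡ zero zero (suc zero) zero zero    zero          eq = refl
words-10≡ zero zero (suc zero) zero zero    (suc zero)    eq = refl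
words-10≡ zero zero (suc zero) zero zero    (suc (suc b)) eq = refl
words-10≡ zero zero (suc zero) zero (suc a) b             eq = refl
words-10≡ zero x w (suc r) a b eq = contradiction (trans eq (shift x w r)) λ ()
  where
  shift : ∀ x w r → x + w + (suc r + suc r) ≡ 2 + (x + w + (r + r))
  shift = solve-∀
words-10≡ (suc n) x w r a b eq = begin
  words true false (suc n) x w r a b
    ≡⟨ words-10 n x w r a b ⟩
  delay (λ w → words false false n x w r a b) w + delay (λ r → delay (λ b → words false true n x w r a b) b) r
    ≡⟨ cong₂ _+_ (on-0 w eq) (on-1 r b eq) ⟩
  X * blocks w 1 r b + X * delay (blocks w 0 r) b
    ≡⟨ +-comm (X * blocks w 1 r b) _ ⟩
  X * delay (blocks w 0 r) b + X * blocks w 1 r b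
    ≡⟨ *-distribˡ-+ X (delay (blocks w 0 r) b) _ ⟨
  X * blocks w 0 (suc r) b ∎
  where
  open ≡-Reasoning
  X = blocks x 0 r a
  on-0 : ∀ w → 2 + n ≡ x + w + (r + r) →
                 delay (λ w → words false false n x w r a b) w ≡ X * blocks w 1 r b
  on-0 zero    eq rewrite blocks-zero 0 r b = sym (*-zeroʳ X)
  on-0 (suc w) eq = words-00≡ n x w r a b (suc-injective (trans eq (cong (_+ (r + r)) (+-suc x w))))
  on-1 : ∀ r b → 2 + n ≡ x + w + (r + r) →
         delay (λ r → delay (λ b → words false true n x w r a b) b) r ≡ blocks x 0 r a * delay (blocks w 0 r) b
  -- No run may start any more. The product vanishes too: `x + w` is positive, whereas zero blocks
  -- have excess 0.
  on-1 zero    b       eq = sym (no-blocks x w b eq)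
    where
    no-blocks : ∀ x w b → 2 + n ≡ x + w + 0 → blocks x 0 0 a * delay (blocks w 0 0) b ≡ 0
    no-blocks (suc x) w       b       eq rewrite blocks-none x a = refl
    no-blocks zero    (suc w) zero    eq = *-zeroʳ (blocks 0 0 0 a)
    no-blocks zero    (suc w) (suc b) eq rewrite blocks-none w b = *-zeroʳ (blocks 0 0 0 a)
  on-1 (suc r) zero    eq = sym (*-zeroʳ (blocks x 0 (suc r) a))
  on-1 (suc r) (suc b) eq = words-01≡ n x w r a b (suc-injective (suc-injective (trans eq (shift x w r))))
    where
    shift : ∀ x w r → x + w + (suc r + suc r) ≡ 2 + (x + w + (r + r))
    shift = solve-∀

words-00≡ zero (suc zero) zero zero a b eq rewrite blocks-none 0 a = refl
words-00≡ zero zero (suc zero) zero zero    zero    eq = refl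
words-00≡ zero zero (suc zero) zero zero    (suc b) eq = refl
words-00≡ zero zero (suc zero) zero (suc a) b       eq = refl
words-00≡ zero x w (suc r) a b eq = contradiction (trans eq (shift x w r)) λ ()
  where
  shift : ∀ x w r → x + w + (suc r + suc r) ≡ 2 + (x + w + (r + r))
  shift = solve-∀
words-00≡ (suc n) x w r a b eq = begin
  words false false (suc n) x w r a b
    ≡⟨ words-00 n x w r a b ⟩
  delay (λ w → words false false n x w r a b) w + delay (λ r → words false true n x w r a b) r
    ≡⟨ cong₂ _+_ (on-0 w eq) (on-1 r eq) ⟩
  X * blocks w 1 r b + X * blocks w 0 r b
    ≡⟨ +-comm (X * blocks w 1 r b) _ ⟩
  X * blocks w 0 r b + X * blocks w 1 r b
    ≡⟨ *-distribˡ-+ X (blocks w 0 r b) _ ⟨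
  X * (blocks w 0 r b + blocks w 1 r b)
    ≡⟨ cong (X *_) (blocks-suc w 0 r b) ⟨
  X * blocks (suc w) 1 r b ∎
  where
  open ≡-Reasoning
  X = blocks x 0 r a
  on-0 : ∀ w → 2 + n ≡ x + w + (r + r) →
                 delay (λ w → words false false n x w r a b) w ≡ X * blocks w 1 r b
  on-0 zero    eq rewrite blocks-zero 0 r b = sym (*-zeroʳ X)
  on-0 (suc w) eq = words-00≡ n x w r a b (suc-injective (trans eq (cong (_+ (r + r)) (+-suc x w))))
  on-1 : ∀ r → 2 + n ≡ x + w + (r + r) →
         delay (λ r → words false true n x w r a b) r ≡ blocks x 0 r a * blocks w 0 r b
  on-1 zero    eq = sym (no-blocks x w eq)
    where
    no-blocks : ∀ x w → 2 + n ≡ x + w + 0 → blocks x 0 0 a * blocks w 0 0 b ≡ 0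
    no-blocks (suc x) w       eq rewrite blocks-none x a = refl
    no-blocks zero    (suc w) eq rewrite blocks-none w b = *-zeroʳ (blocks 0 0 0 a)
  on-1 (suc r) eq = words-01≡ n x w r a b (suc-injective (suc-injective (trans eq (shift x w r))))
    where
    shift : ∀ x w r → x + w + (suc r + suc r) ≡ 2 + (x + w + (r + r))
    shift = solve-∀

-- Cyclic words

at : ∀ {n} → Subset n → ℕ → ℕ
at []      i       = 0
at (a ∷ v) zero    = bit a
at (a ∷ v) (suc i) = at v i

-- With natural numbers as indices the cyclic shift by `j` becomes plain addition, so sums can be
-- shifted without handling residues.
periodic : ∀ {n} → Subset (suc n) → ℕ → ℕ
periodic {n} A i = at A (i % suc n)

indicator≡at : ∀ {n} (A : Subset n) t → indicator A t ≡ at A (toℕ t)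
indicator≡at (true  ∷ A) zero    = refl
indicator≡at (false ∷ A) zero    = refl
indicator≡at (a     ∷ A) (suc t) with lookup A t | indicator≡at A t
... | true  | eq = eq
... | false | eq = eq

periodic-toℕ : ∀ {n} (A : Subset (suc n)) t → periodic A (toℕ t) ≡ at A (toℕ t)
periodic-toℕ A t = cong (at A) (m<n⇒m%n≡m (toℕ<n t))

D≡∑periodic : ∀ {n} j (A : Subset (suc n)) → D j A ≡ ∑[ t < suc n ] (periodic A (toℕ t) * periodic A (toℕ t + j))
D≡∑periodic {n} j A = sum-cong-≗ λ t → cong₂ _*_
  (trans (indicator≡at A t) (sym (periodic-toℕ A t)))
  (trans (indicator≡at A (t ⊕ j)) (cong (at A) (toℕ-fromℕ< (m%n<n (toℕ t + j) (suc n)))))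

∣∣≡∑at : ∀ {n} (A : Subset n) → ∣ A ∣ ≡ ∑[ t < n ] at A (toℕ t)
∣∣≡∑at []          = refl
∣∣≡∑at (true  ∷ A) = cong suc (∣∣≡∑at A)
∣∣≡∑at (false ∷ A) = ∣∣≡∑at A

∣∣≡∑periodic : ∀ {n} (A : Subset (suc n)) → ∣ A ∣ ≡ ∑[ t < suc n ] periodic A (toℕ t)
∣∣≡∑periodic A = trans (∣∣≡∑at A) (sum-cong-≗ λ t → sym (periodic-toℕ A t))

at-∷ʳ-< : ∀ {n} (v : Subset n) a {i} → i < n → at (v ∷ʳ a) i ≡ at v i
at-∷ʳ-< (b ∷ v) a {zero}  i<n       = refl
at-∷ʳ-< (b ∷ v) a {suc i} (s≤s i<n) = at-∷ʳ-< v a i<n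

at-∷ʳ-last : ∀ {n} (v : Subset n) a → at (v ∷ʳ a) n ≡ bit a
at-∷ʳ-last []      a = refl
at-∷ʳ-last (b ∷ v) a = at-∷ʳ-last v a

rotate : ∀ {n} → Subset n → Subset n
rotate []      = []
rotate (a ∷ v) = v ∷ʳ a

suc-% : ∀ i n → suc i % suc n ≡ suc (i % suc n) % suc n
suc-% i n = begin
  suc i % suc n                             ≡⟨ cong (_% suc n) (+-comm 1 i) ⟩
  (i + 1) % suc n                           ≡⟨ %-distribˡ-+ i 1 (suc n) ⟩
  (i % suc n + 1 % suc n) % suc n           ≡⟨ cong (λ j → (j + 1 % suc n) % suc n) (m<n⇒m%n≡m (m%n<n i (suc n))) ⟨
  (i % suc n % suc n + 1 % suc n) % suc n   ≡⟨ %-distribˡ-+ (i % suc n) 1 (suc n) ⟨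
  (i % suc n + 1) % suc n                   ≡⟨ cong (_% suc n) (+-comm (i % suc n) 1) ⟩
  suc (i % suc n) % suc n                   ∎
  where open ≡-Reasoning

periodic-rotate : ∀ {n} (A : Subset (suc n)) i → periodic (rotate A) i ≡ periodic A (suc i)
periodic-rotate {n} (a ∷ v) i = trans (step (i % suc n) (m%n<n i (suc n))) (cong (at (a ∷ v)) (sym (suc-% i n)))
  where
  step : ∀ j → j < suc n → at (v ∷ʳ a) j ≡ at (a ∷ v) (suc j % suc n)
  step j j<1+n with j <? n
  ... | yes j<n rewrite m<n⇒m%n≡m (s≤s j<n) = at-∷ʳ-< v a j<n
  -- Here `j = n`: the moved letter `a` stands last, and the index `suc n` wraps around to 0.
  ... | no  j≮n rewrite ≤-antisym (≤-pred j<1+n) (≮⇒≥ j≮n) =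
    trans (at-∷ʳ-last v a) (cong (at (a ∷ v)) (sym (n%n≡0 (suc n))))

periodic-wrap : ∀ {n} (A : Subset (suc n)) i → periodic A (suc n + i) ≡ periodic A i
periodic-wrap {n} A i = cong (at A) (trans (cong (_% suc n) (+-comm (suc n) i)) ([m+n]%n≡m%n i (suc n)))

-- Both sides are the sum of `g` over 0, ..., `n`; keeping the end terms avoids subtraction.
∑-shift : ∀ n (g : ℕ → ℕ) → ∑[ t < n ] g (suc (toℕ t)) + g 0 ≡ ∑[ t < n ] g (toℕ t) + g n
∑-shift zero    g = refl
∑-shift (suc n) g = begin
  g 1 + S + g 0    ≡⟨ swap (g 1) S (g 0) ⟩
  g 0 + (S + g 1)  ≡⟨ cong (_+_ (g 0)) (∑-shift n (g ∘ suc)) ⟩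
  g 0 + (∑[ t < n ] g (suc (toℕ t)) + g (suc n)) ≡⟨ +-assoc (g 0) _ _ ⟨
  g 0 + ∑[ t < n ] g (suc (toℕ t)) + g (suc n) ∎
  where
  open ≡-Reasoning
  S = ∑[ t < n ] g (suc (suc (toℕ t)))
  swap : ∀ a b c → a + b + c ≡ c + (b + a)
  swap = solve-∀

∑-periodic-shift : ∀ n (g : ℕ → ℕ) → g n ≡ g 0 → ∑[ t < n ] g (suc (toℕ t)) ≡ ∑[ t < n ] g (toℕ t)
∑-periodic-shift n g eq = +-cancelʳ-≡ (g 0) _ _ (trans (∑-shift n g) (cong (_+_ (∑[ t < n ] g (toℕ t))) eq))

wrap₀ : ∀ {n} (A : Subset (suc n)) → periodic A (suc n) ≡ periodic A 0
wrap₀ {n} A = trans (cong (periodic A) (sym (+-identityʳ (suc n)))) (periodic-wrap A 0)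

D-rotate : ∀ {n} j (A : Subset (suc n)) → D j (rotate A) ≡ D j A
D-rotate {n} j A = begin
  D j (rotate A)
    ≡⟨ D≡∑periodic j (rotate A) ⟩
  ∑[ t < suc n ] (periodic (rotate A) (toℕ t) * periodic (rotate A) (toℕ t + j))
    ≡⟨ sum-cong-≗ {suc n} (λ t → cong₂ _*_ (periodic-rotate A (toℕ t)) (periodic-rotate A (toℕ t + j))) ⟩
  ∑[ t < suc n ] (periodic A (suc (toℕ t)) * periodic A (suc (toℕ t) + j))
    ≡⟨ ∑-periodic-shift (suc n) (λ i → periodic A i * periodic A (i + j)) (cong₂ _*_ (wrap₀ A) (periodic-wrap A j)) ⟩
  ∑[ t < suc n ] (periodic A (toℕ t) * periodic A (toℕ t + j))
    ≡⟨ D≡∑periodic j A ⟨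
  D j A ∎
  where open ≡-Reasoning

∣∣-rotate : ∀ {n} (A : Subset (suc n)) → ∣ rotate A ∣ ≡ ∣ A ∣
∣∣-rotate {n} A = begin
  ∣ rotate A ∣                                ≡⟨ ∣∣≡∑periodic (rotate A) ⟩
  ∑[ t < suc n ] periodic (rotate A) (toℕ t)  ≡⟨ sum-cong-≗ {suc n} (λ t → periodic-rotate A (toℕ t)) ⟩
  ∑[ t < suc n ] periodic A (suc (toℕ t))     ≡⟨ ∑-periodic-shift (suc n) (periodic A) (wrap₀ A) ⟩
  ∑[ t < suc n ] periodic A (toℕ t)           ≡⟨ ∣∣≡∑periodic A ⟨
  ∣ A ∣                                       ∎
  where open ≡-Reasoning

-- `subsets` branches on the first letter; the induction interchanges the choices of the first and
-- the last letter.
sumOver-subsets-∷ʳ : ∀ n (F : Subset (suc n) → ℕ) → sumOver (subsets (suc n)) F ≡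
                     sumOver (subsets n) (F ∘ (_∷ʳ outside)) + sumOver (subsets n) (F ∘ (_∷ʳ inside))
sumOver-subsets-∷ʳ zero    F = sumOver-subsets-suc 0 F
sumOver-subsets-∷ʳ (suc n) F = begin
  sumOver (subsets (2 + n)) F
    ≡⟨ sumOver-subsets-suc (suc n) F ⟩
  sumOver (subsets (suc n)) (F ∘ (outside ∷_)) + sumOver (subsets (suc n)) (F ∘ (inside ∷_))
    ≡⟨ cong₂ _+_ (sumOver-subsets-∷ʳ n (F ∘ (outside ∷_))) (sumOver-subsets-∷ʳ n (F ∘ (inside ∷_))) ⟩
  S outside outside + S outside inside + (S inside outside + S inside inside)
    ≡⟨ +-interchange (S outside outside) _ _ _ ⟩
  S outside outside + S inside outside + (S outside inside + S inside inside)
    ≡⟨ cong₂ _+_ (sumOver-subsets-suc n (F ∘ (_∷ʳ outside))) (sumOver-subsets-suc n (F ∘ (_∷ʳ inside))) ⟨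
  sumOver (subsets (suc n)) (F ∘ (_∷ʳ outside)) + sumOver (subsets (suc n)) (F ∘ (_∷ʳ inside)) ∎
  where
  open ≡-Reasoning
  S : Bool → Bool → ℕ
  S a b = sumOver (subsets n) (λ v → F (a ∷ (v ∷ʳ b)))

sumOver-rotate : ∀ n (F : Subset n → ℕ) → sumOver (subsets n) (F ∘ rotate) ≡ sumOver (subsets n) F
sumOver-rotate zero    F = refl
sumOver-rotate (suc n) F = trans (sumOver-subsets-suc n (F ∘ rotate)) (sym (sumOver-subsets-∷ʳ n F))

-- Rises and double counting

rise : ∀ {n} → Subset (suc n) → ℕ → ℕ
rise A t = (1 ∸ periodic A t) * periodic A (suc t)

-- The cyclic predecessor of an element is either outside the set, which gives a rise, or in it,
-- which gives an incidence at distance 1.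
∑rise+D₁≡∣∣ : ∀ {n} (A : Subset (suc n)) → ∑[ t < suc n ] rise A (toℕ t) + D 1 A ≡ ∣ A ∣
∑rise+D₁≡∣∣ {n} A = begin
  ∑[ t < suc n ] rise A (toℕ t) + D 1 A
    ≡⟨ cong (_+_ (∑[ t < suc n ] rise A (toℕ t))) (D≡∑periodic 1 A) ⟩
  ∑[ t < suc n ] rise A (toℕ t) + ∑[ t < suc n ] (periodic A (toℕ t) * periodic A (toℕ t + 1))
    ≡⟨ ∑-distrib-+ {suc n} (λ t → rise A (toℕ t)) (λ t → periodic A (toℕ t) * periodic A (toℕ t + 1)) ⟨
  ∑[ t < suc n ] (rise A (toℕ t) + periodic A (toℕ t) * periodic A (toℕ t + 1))
    ≡⟨ sum-cong-≗ {suc n} (λ t → split (toℕ t)) ⟩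
  ∑[ t < suc n ] periodic A (suc (toℕ t))
    ≡⟨ ∑-periodic-shift (suc n) (periodic A) (wrap₀ A) ⟩
  ∑[ t < suc n ] periodic A (toℕ t)
    ≡⟨ ∣∣≡∑periodic A ⟨
  ∣ A ∣ ∎
  where
  open ≡-Reasoning
  at≤1 : ∀ {n} (v : Subset n) i → at v i ≤ 1
  at≤1 []          i       = z≤n
  at≤1 (true  ∷ v) zero    = s≤s z≤n
  at≤1 (false ∷ v) zero    = z≤n
  at≤1 (a     ∷ v) (suc i) = at≤1 v i
  split : ∀ t → rise A t + periodic A t * periodic A (t + 1) ≡ periodic A (suc t)
  split t rewrite +-comm t 1 = begin
    (1 ∸ p) * q + p * q   ≡⟨ *-distribʳ-+ q (1 ∸ p) p ⟨
    (1 ∸ p + p) * q       ≡⟨ cong (_* q) (m∸n+n≡m (at≤1 A (t % suc n))) ⟩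
    1 * q                 ≡⟨ *-identityˡ q ⟩
    q                     ∎
    where
    p = periodic A t
    q = periodic A (suc t)

sumOver-∑ : ∀ {a} {A : Set a} (xs : List A) n (G : ℕ → A → ℕ) c → (∀ t → sumOver xs (G t) ≡ c) →
            sumOver xs (λ z → ∑[ t < n ] G (toℕ t) z) ≡ n * c
sumOver-∑ xs zero    G c eq = sumOver-zero xs λ _ → refl
sumOver-∑ xs (suc n) G c eq =
  trans (sumOver-+ xs (G 0) _) (cong₂ _+_ (eq 0) (sumOver-∑ xs n (G ∘ suc) c (eq ∘ suc)))

*-distribˡ-∑ : ∀ c n (g : ℕ → ℕ) → c * ∑[ t < n ] g (toℕ t) ≡ ∑[ t < n ] (c * g (toℕ t))
*-distribˡ-∑ c zero    g = *-zeroʳ c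
*-distribˡ-∑ c (suc n) g = trans (*-distribˡ-+ c (g 0) _) (cong (_+_ (c * g 0)) (*-distribˡ-∑ c n (g ∘ suc)))

-- Rotation moves every rise to position 0.
sumOver-rises : ∀ n (F : Subset (2 + n) → ℕ) → (∀ A → F (rotate A) ≡ F A) →
                sumOver (subsets (2 + n)) (λ A → F A * ∑[ t < 2 + n ] rise A (toℕ t)) ≡
                (2 + n) * sumOver (subsets n) (λ u → F (outside ∷ inside ∷ u))
sumOver-rises n F F-rotate =
  trans (sumOver-cong Ω λ A → *-distribˡ-∑ (F A) (2 + n) (rise A))
        (sumOver-∑ Ω (2 + n) (λ t A → F A * rise A t) _ λ t → trans (move t) rise-at-0)
  where
  open ≡-Reasoning
  Ω = subsets (2 + n)
  move : ∀ t → sumOver Ω (λ A → F A * rise A t) ≡ sumOver Ω (λ A → F A * rise A 0)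
  move zero    = refl
  move (suc t) = begin
    sumOver Ω (λ A → F A * rise A (suc t))
      ≡⟨ sumOver-cong Ω (λ A → cong₂ _*_ (F-rotate A)
           (cong₂ (λ p q → (1 ∸ p) * q) (periodic-rotate A t) (periodic-rotate A (suc t)))) ⟨
    sumOver Ω (λ A → F (rotate A) * rise (rotate A) t)
      ≡⟨ sumOver-rotate (2 + n) (λ A → F A * rise A t) ⟩
    sumOver Ω (λ A → F A * rise A t)
      ≡⟨ move t ⟩
    sumOver Ω (λ A → F A * rise A 0) ∎
  rise-at-0 : sumOver Ω (λ A → F A * rise A 0) ≡ sumOver (subsets n) (λ u → F (outside ∷ inside ∷ u))
  rise-at-0 = begin
    sumOver Ω (λ A → F A * rise A 0)
      ≡⟨ sumOver-subsets-suc (suc n) _ ⟩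
    sumOver (subsets (suc n)) (λ v → F (outside ∷ v) * rise (outside ∷ v) 0) +
    sumOver (subsets (suc n)) (λ v → F (inside ∷ v) * rise (inside ∷ v) 0)
      -- By computation, the rise at 0 is 0 for words beginning with 1 or 00 and is 1 for words
      -- beginning with 01.
      ≡⟨ cong₂ _+_ (sumOver-subsets-suc n _) (sumOver-zero (subsets (suc n)) λ v → *-zeroʳ (F (inside ∷ v))) ⟩
    sumOver (subsets n) (λ u → F (outside ∷ outside ∷ u) * 0) +
    sumOver (subsets n) (λ u → F (outside ∷ inside ∷ u) * 1) + 0
      ≡⟨ +-identityʳ _ ⟩
    sumOver (subsets n) (λ u → F (outside ∷ outside ∷ u) * 0) +
    sumOver (subsets n) (λ u → F (outside ∷ inside ∷ u) * 1)
      ≡⟨ cong₂ _+_ (sumOver-zero (subsets n) λ u → *-zeroʳ (F (outside ∷ outside ∷ u)))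
                   (sumOver-cong (subsets n) λ u → *-identityʳ (F (outside ∷ inside ∷ u))) ⟩
    sumOver (subsets n) (λ u → F (outside ∷ inside ∷ u)) ∎

-- Reading a cyclic word as a linear one

-- The closing values 0 and 1 are the virtual letters. Shifting `g` along the word lets sums over
-- positions and the recursive statistics be compared by one induction.
Reads : ∀ {n} → (ℕ → ℕ) → Bool → Bool → Subset n → Set
Reads g p q []      = g 0 ≡ bit p × g 1 ≡ bit q × g 2 ≡ 0 × g 3 ≡ 1
Reads g p q (c ∷ u) = g 0 ≡ bit p × Reads (g ∘ suc) q c u

Reads-head : ∀ {n} {g : ℕ → ℕ} {p q} (u : Subset n) → Reads g p q u → g 0 ≡ bit p
Reads-head []      (g₀ , _) = g₀
Reads-head (c ∷ u) (g₀ , _) = g₀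

Reads-second : ∀ {n} {g : ℕ → ℕ} {p q} (u : Subset n) → Reads g p q u → g 1 ≡ bit q
Reads-second []      (_ , g₁ , _) = g₁
Reads-second (c ∷ u) (_ , reads)  = Reads-head u reads

bit-∧ : ∀ p q → bit p * bit q ≡ bit (p ∧ q)
bit-∧ false q     = refl
bit-∧ true  false = refl
bit-∧ true  true  = refl

∑≡gapped-pairs : ∀ {n} {g : ℕ → ℕ} {p q} (u : Subset n) → Reads g p q u →
                 ∑[ t < 2 + n ] (g (toℕ t) * g (2 + toℕ t)) ≡ gapped-pairs p q u
-- Two products remain, `p` with the virtual 0 and `q` with the virtual 1.
∑≡gapped-pairs {p = p} {q} [] (g₀ , g₁ , g₂ , g₃)
  rewrite g₀ | g₁ | g₂ | g₃ | *-zeroʳ (bit p) | *-identityʳ (bit q) = +-identityʳ (bit q)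
∑≡gapped-pairs {p = p} {q} (c ∷ u) (g₀ , reads) =
  cong₂ _+_ (trans (cong₂ _*_ g₀ (Reads-second u reads)) (bit-∧ p c)) (∑≡gapped-pairs u reads)

∑≡one-pairs : ∀ {n} {g : ℕ → ℕ} {p q} (u : Subset n) → Reads g p q u →
              ∑[ t < 1 + n ] (g (1 + toℕ t) * g (2 + toℕ t)) ≡ one-pairs p q u
∑≡one-pairs {q = q} [] (g₀ , g₁ , g₂ , g₃)
  rewrite g₁ | g₂ | *-zeroʳ (bit q) = refl
∑≡one-pairs {q = q} (c ∷ u) (g₀ , reads) =
  cong₂ _+_ (trans (cong₂ _*_ (Reads-head u reads) (Reads-second u reads)) (bit-∧ q c)) (∑≡one-pairs u reads)

at⇒Reads : ∀ {n} {g : ℕ → ℕ} {p q} (u : Subset n) → g 0 ≡ bit p → g 1 ≡ bit q →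
           (∀ {i} → i < n → g (2 + i) ≡ at u i) → g (2 + n) ≡ 0 → g (3 + n) ≡ 1 → Reads g p q u
at⇒Reads []      g₀ g₁ gᵢ gₙ gₙ₊₁ = g₀ , g₁ , gₙ , gₙ₊₁
at⇒Reads (c ∷ u) g₀ g₁ gᵢ gₙ gₙ₊₁ = g₀ , at⇒Reads u g₁ (gᵢ (s≤s z≤n)) (gᵢ ∘ s≤s) gₙ gₙ₊₁

-- After `2 + n` places the periodic extension returns to its first letters 0 and 1, which serve as
-- the virtual ones.
Reads-periodic : ∀ {n} (u : Subset n) → Reads (periodic (outside ∷ inside ∷ u)) false true u
Reads-periodic {n} u = at⇒Reads u refl refl
  (λ i<n → cong (at A) (m<n⇒m%n≡m (s≤s (s≤s i<n))))
  (wrap₀ A)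
  (trans (cong (periodic A) (+-comm 1 (2 + n))) (periodic-wrap A 1))
  where A = outside ∷ inside ∷ u

D₁≡one-pairs : ∀ {n} (u : Subset n) → D 1 (outside ∷ inside ∷ u) ≡ one-pairs false true u
D₁≡one-pairs {n} u = trans (D≡∑periodic 1 A) (trans
  -- The term at position 0 vanishes by computation, as the word begins with 0; this leaves `suc n`
  -- terms.
  (sum-cong-≗ {suc n} λ t → cong (λ i → periodic A (1 + toℕ t) * periodic A (suc i)) (+-comm (toℕ t) 1))
  (∑≡one-pairs {g = periodic A} u (Reads-periodic u)))
  where A = outside ∷ inside ∷ u

D₂≡gapped-pairs : ∀ {n} (u : Subset n) → D 2 (outside ∷ inside ∷ u) ≡ gapped-pairs false true u
D₂≡gapped-pairs {n} u = trans (D≡∑periodic 2 A) (trans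
  (sum-cong-≗ {2 + n} λ t → cong (λ i → periodic A (toℕ t) * periodic A i) (+-comm (toℕ t) 2))
  (∑≡gapped-pairs {g = periodic A} u (Reads-periodic u)))
  where A = outside ∷ inside ∷ u

-- Sums over pairs with a prescribed sum

sumOver-applyUpTo : ∀ {a} {A : Set a} (f : ℕ → A) n (F : A → ℕ) → sumOver (applyUpTo f n) F ≡ ∑[ t < n ] F (f (toℕ t))
sumOver-applyUpTo f zero    F = refl
sumOver-applyUpTo f (suc n) F = cong (_+_ (F (f 0))) (sumOver-applyUpTo (f ∘ suc) n F)

sumOver-pairsWithSum : ∀ m (F : ℕ × ℕ → ℕ) → sumOver (pairsWithSum (+ m)) F ≡ ∑[ t < suc m ] F (toℕ t , m ∸ toℕ t)
sumOver-pairsWithSum m F = trans (cong List.sum (sym (map-∘ (upTo (suc m)))))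
  (sumOver-applyUpTo (λ a → a) (suc m) (λ a → F (a , m ∸ a)))

-- Only `t = i` can contribute, and it does exactly when the complement `m - i` is `j`.
∑-δ-δ : ∀ i j m → ∑[ t < suc m ] (δ i (toℕ t) * δ j (m ∸ toℕ t)) ≡ δ (i + j) m
∑-δ-δ zero    j m       = trans (cong₂ _+_ (*-identityˡ (δ j m)) (∑-zero m)) (+-identityʳ (δ j m))
  where
  ∑-zero : ∀ n → ∑[ t < n ] 0 ≡ 0
  ∑-zero zero    = refl
  ∑-zero (suc n) = ∑-zero n
∑-δ-δ (suc i) j zero    = refl
∑-δ-δ (suc i) j (suc m) = ∑-δ-δ i j m

sumOver-pairs-δ : ∀ p q i j → sumOver (pairsWithSum (+ p ℤ.- + q)) (λ (a , b) → δ i a * δ j b) ≡ δ (i + j + q) p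
sumOver-pairs-δ p q i j rewrite ℤ.m-n≡m⊖n p q with q ≤? p
... | yes q≤p rewrite ℤ.⊖-≥ q≤p = trans (sumOver-pairsWithSum (p ∸ q) (λ (a , b) → δ i a * δ j b))
  (trans (∑-δ-δ i j (p ∸ q)) (δ-cong-⇔ (λ eq → trans (cong (_+ q) eq) (m∸n+n≡m q≤p))
                                       (λ eq → trans (sym (m+n∸n≡m (i + j) q)) (cong (_∸ q) eq))))
-- The difference is negative and is exposed as such, so there are no pairs; on the other side
-- `i + j + q` exceeds `p`.
... | no  q≰p rewrite ℤ.⊖-< (≰⇒> q≰p) | sym (suc-pred (q ∸ p) {{>-nonZero (m<n⇒0<n∸m (≰⇒> q≰p))}}) =
  sym (δ-≢ (λ eq → q≰p (subst (q ≤_) eq (m≤n+m q (i + j)))))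

-- Binomial coefficients

binom-+ : ∀ t s → binom (+ t) (+ s) ≡ t C s
binom-+ t s with + t ℤ.≟ + s
... | yes refl = sym (nCn≡1 t)
... | no  _    = refl

-- The convention that `binom` is 1 at (-1, -1) accounts for the empty composition of 0; the other
-- boundary values are 0 on both sides.
compositions≡binom : ∀ x d → compositions x d ≡ binom (+ x ℤ.- 1ℤ) (+ d ℤ.- 1ℤ)
compositions≡binom zero    zero    = refl
compositions≡binom zero    (suc d) = refl
compositions≡binom (suc x) zero    = refl
compositions≡binom (suc x) (suc d) = trans (compositions-suc x d) (sym (binom-+ x d))

blocks≡binom : ∀ x r a → blocks x 0 r a ≡ binom (+ r) (+ a) * binom (+ x ℤ.- 1ℤ) (+ r ℤ.- + a ℤ.- 1ℤ)
blocks≡binom x r a rewrite blocks≡C*compositions x 0 r a | binom-+ r a with a ≤? r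
... | yes a≤r rewrite ℤ.m-n≡m⊖n r a | ℤ.⊖-≥ a≤r = cong ((r C a) *_) (compositions≡binom x (r ∸ a))
-- Truncated and integer difference disagree here, but the factor `r C a` is 0.
... | no  a≰r rewrite k>n⇒nCk≡0 (≰⇒> a≰r) = refl

-- Counting

weight : ∀ {n} → ℕ → ℕ → ℕ → Subset n → ℕ
weight k x y A = δ ∣ A ∣ k * (δ (D 1 A) x * δ (D 2 A) y)

sumOver-filter : ∀ {a p} {A : Set a} {Q : Pred A p} (Q? : Decidable Q) (xs : List A) (f : A → ℕ) →
                 sumOver (filter Q? xs) f ≡ sumOver xs (λ z → bit (does (Q? z)) * f z)
sumOver-filter Q? []       f = refl
sumOver-filter Q? (z ∷ xs) f with does (Q? z)
... | true  = cong₂ _+_ (sym (*-identityˡ (f z))) (sumOver-filter Q? xs f)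
... | false = sumOver-filter Q? xs f

length≡sumOver : ∀ {a} {A : Set a} (xs : List A) → length xs ≡ sumOver xs (λ _ → 1)
length≡sumOver []       = refl
length≡sumOver (z ∷ xs) = cong suc (length≡sumOver xs)

count≡weight : ∀ n k x y → count (λ A → (D 1 A ≟ x) ×-dec (D 2 A ≟ y)) (kSubsets n k) ≡ sumOver (subsets n) (weight k x y)
count≡weight n k x y = begin
  count E? (kSubsets n k)
    ≡⟨ length≡sumOver (filter E? (kSubsets n k)) ⟩
  sumOver (filter E? (kSubsets n k)) (λ _ → 1)
    ≡⟨ sumOver-filter E? (kSubsets n k) _ ⟩
  sumOver (kSubsets n k) (λ A → bit (does (E? A)) * 1)
    -- `does (m ≟ n)` computes to `m ≡ᵇ n`, which turns the decisions into `δ`.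
    ≡⟨ sumOver-filter (λ A → ∣ A ∣ ≟ k) (subsets n) _ ⟩
  sumOver (subsets n) (λ A → δ ∣ A ∣ k * (bit (does (E? A)) * 1))
    ≡⟨ sumOver-cong (subsets n) (λ A → cong (δ ∣ A ∣ k *_)
         (trans (*-identityʳ _) (sym (bit-∧ (D 1 A ≡ᵇ x) (D 2 A ≡ᵇ y))))) ⟩
  sumOver (subsets n) (weight k x y) ∎
  where
  open ≡-Reasoning
  E? : Decidable (λ A → D 1 A ≡ x × D 2 A ≡ y)
  E? A = (D 1 A ≟ x) ×-dec (D 2 A ≟ y)

sumOver-δ-∣∣ : ∀ n k → sumOver (subsets n) (λ A → δ ∣ A ∣ k) ≡ n C k
sumOver-δ-∣∣ zero    zero    = refl
sumOver-δ-∣∣ zero    (suc k) = refl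
sumOver-δ-∣∣ (suc n) zero    = trans (sumOver-subsets-suc n _)
  (cong₂ _+_ (sumOver-δ-∣∣ n 0) (sumOver-zero (subsets n) λ _ → refl))
sumOver-δ-∣∣ (suc n) (suc k) = trans (sumOver-subsets-suc n _)
  (trans (cong₂ _+_ (sumOver-δ-∣∣ n (suc k)) (sumOver-δ-∣∣ n k))
         (trans (+-comm (n C suc k) _) (nCk+nC[k+1]≡[n+1]C[k+1] n k)))

length-kSubsets : ∀ n k → length (kSubsets n k) ≡ n C k
length-kSubsets n k = begin
  length (kSubsets n k)                          ≡⟨ length≡sumOver (kSubsets n k) ⟩
  sumOver (kSubsets n k) (λ _ → 1)               ≡⟨ sumOver-filter (λ A → ∣ A ∣ ≟ k) (subsets n) _ ⟩
  sumOver (subsets n) (λ A → δ ∣ A ∣ k * 1)      ≡⟨ sumOver-cong (subsets n) (λ A → *-identityʳ _) ⟩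
  sumOver (subsets n) (λ A → δ ∣ A ∣ k)          ≡⟨ sumOver-δ-∣∣ n k ⟩
  n C k                                          ∎
  where open ≡-Reasoning

weight-rotate : ∀ {n} k x y (A : Subset (suc n)) → weight k x y (rotate A) ≡ weight k x y A
weight-rotate k x y A rewrite ∣∣-rotate A | D-rotate 1 A | D-rotate 2 A = refl

-- Where the weight is nonzero, the set has `x + r` elements and `x` incidences at distance 1, hence
-- `r` rises; elsewhere both sides are 0.
weight-rises : ∀ {n} x r y (A : Subset (suc n)) →
               r * weight (x + r) x y A ≡ weight (x + r) x y A * ∑[ t < suc n ] rise A (toℕ t)
weight-rises {n} x r y A with ∣ A ∣ ≟ x + r
... | no  ≢k rewrite δ-≢ ≢k = *-zeroʳ r
... | yes ≡k with D 1 A ≟ x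
...   | no  ≢x rewrite δ-≢ ≢x | *-zeroʳ (δ ∣ A ∣ (x + r)) = *-zeroʳ r
...   | yes ≡x = trans (*-comm r _) (cong (weight (x + r) x y A *_) (sym (+-cancelʳ-≡ x _ _ (begin
  ∑[ t < suc n ] rise A (toℕ t) + x      ≡⟨ cong (_+_ (∑[ t < suc n ] rise A (toℕ t))) ≡x ⟨
  ∑[ t < suc n ] rise A (toℕ t) + D 1 A  ≡⟨ ∑rise+D₁≡∣∣ A ⟩
  ∣ A ∣                                  ≡⟨ ≡k ⟩
  x + r                                  ≡⟨ +-comm x r ⟩
  r + x                                  ∎))))
  where open ≡-Reasoning

-- Once `x` and `r` are fixed, the length forces `w` and the cardinality, and `gapped-identity`
-- makes `D 2` equal to `y` exactly when the numbers of lone ones and lone zeros add up to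
-- `k + y - 2x`. So at most one pair `(a , b)` contributes.
weight-words : ∀ {n} x w r y → n ≡ x + w + (r + r) → (u : Subset n) →
  weight (x + suc r) x y (outside ∷ inside ∷ u) ≡
  sumOver (pairsWithSum (+ (x + suc r + y) ℤ.- + (2 * x))) (λ (a , b) → tally false true x w r a b u)
weight-words {n} x w r y n≡ u = sym (begin
  sumOver ps (λ (a , b) → X * (W * (R * (δ SA a * δ SB b))))
    ≡⟨ sumOver-*ˡ ps X _ ⟩
  X * sumOver ps (λ (a , b) → W * (R * (δ SA a * δ SB b)))
    ≡⟨ cong (X *_) (sumOver-*ˡ ps W _) ⟩
  X * (W * sumOver ps (λ (a , b) → R * (δ SA a * δ SB b)))
    ≡⟨ cong (λ z → X * (W * z)) (sumOver-*ˡ ps R _) ⟩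
  X * (W * (R * sumOver ps (λ (a , b) → δ SA a * δ SB b)))
    ≡⟨ cong (λ z → X * (W * (R * z))) (sumOver-pairs-δ (k + y) (2 * x) SA SB) ⟩
  X * (W * (R * δ (SA + SB + 2 * x) (k + y)))
    ≡⟨ agree ⟩
  δ (suc ∣ u ∣) k * (X * δ (gapped-pairs false true u) y)
    ≡⟨ cong₂ (λ d₁ d₂ → δ (suc ∣ u ∣) k * (δ d₁ x * δ d₂ y)) (D₁≡one-pairs u) (D₂≡gapped-pairs u) ⟨
  weight k x y (outside ∷ inside ∷ u) ∎)
  where
  open ≡-Reasoning
  k  = x + suc r
  ps = pairsWithSum (+ (k + y) ℤ.- + (2 * x))
  X  = δ (one-pairs false true u) x
  W  = δ (zero-pairs false true u) w
  R  = δ (starts false true u) r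
  SA = lone-ones false true u
  SB = lone-zeros false true u
  G  = gapped-pairs false true u

  agree : X * (W * (R * δ (SA + SB + 2 * x) (k + y))) ≡ δ (suc ∣ u ∣) k * (X * δ G y)
  agree with one-pairs false true u ≟ x
  ... | no  ≢x rewrite δ-≢ ≢x = sym (*-zeroʳ (δ (suc ∣ u ∣) k))
  ... | yes ≡x with starts false true u ≟ r
  -- The cardinality determines the number of starts, so with a wrong number `δ (suc ∣ u ∣) k`
  -- vanishes as well.
  ...   | no  ≢r rewrite δ-≢ ≢r | *-zeroʳ W | *-zeroʳ X =
          sym (cong (_* (X * δ G y)) (δ-≢ λ eq → ≢r (+-cancelˡ-≡ x _ _ (begin
            x + starts false true u                       ≡⟨ cong (_+ starts false true u) ≡x ⟨
            one-pairs false true u + starts false true u    ≡⟨ one-pairs+starts false true u ⟩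
            ∣ u ∣                                         ≡⟨ suc-injective (trans eq (+-suc x r)) ⟩
            x + r                                         ∎))))
  ...   | yes ≡r = begin
    X * (W * (R * δ (SA + SB + 2 * x) (k + y)))
      ≡⟨ cong₂ (λ V Q → X * (V * (Q * δ (SA + SB + 2 * x) (k + y)))) (trans (cong (λ z → δ z w) ≡w) (δ-refl w))
                                                                   (trans (cong (λ z → δ z r) ≡r) (δ-refl r)) ⟩
    X * (1 * (1 * δ (SA + SB + 2 * x) (k + y)))
      ≡⟨ drop-ones X _ ⟩
    1 * (X * δ (SA + SB + 2 * x) (k + y))
      ≡⟨ cong₂ (λ K Q → K * (X * Q)) (trans (cong (λ z → δ z k) ≡k) (δ-refl k)) δ-gapped ⟨
    δ (suc ∣ u ∣) k * (X * δ G y) ∎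
    where
    drop-ones : ∀ p q → p * (1 * (1 * q)) ≡ 1 * (p * q)
    drop-ones = solve-∀
    ≡∣u∣ : ∣ u ∣ ≡ x + r
    ≡∣u∣ = trans (sym (one-pairs+starts false true u)) (cong₂ _+_ ≡x ≡r)
    ≡k : suc ∣ u ∣ ≡ k
    ≡k = trans (cong suc ≡∣u∣) (sym (+-suc x r))
    ≡w : zero-pairs false true u ≡ w
    ≡w = +-cancelˡ-≡ x _ _ (+-cancelʳ-≡ (r + r) _ _ (begin
      x + zero-pairs false true u + (r + r)
        ≡⟨ cong₂ (λ e s → e + zero-pairs false true u + (s + s)) ≡x ≡r ⟨
      one-pairs false true u + zero-pairs false true u + (starts false true u + starts false true u)
        ≡⟨ length-identity false true u ⟩
      n + 0
        ≡⟨ trans (+-identityʳ n) n≡ ⟩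
      x + w + (r + r) ∎))
    gapped≡ : G + 1 + (r + r) ≡ x + r + SA + SB
    gapped≡ = begin
      G + 1 + (r + r)
        ≡⟨ cong (λ s → G + 1 + (s + s)) ≡r ⟨
      G + 1 + (starts false true u + starts false true u)
        ≡⟨ gapped-identity false true u ⟩
      ∣ u ∣ + SA + SB
        ≡⟨ cong (λ m → m + SA + SB) ≡∣u∣ ⟩
      x + r + SA + SB ∎
    -- Adding `x` to `gapped≡` turns its left side into `G + k + r`; then `r` cancels.
    G+k≡ : G + k ≡ SA + SB + 2 * x
    G+k≡ = +-cancelʳ-≡ r _ _ (begin
      G + (x + suc r) + r        ≡⟨ out G x r ⟩
      G + 1 + (r + r) + x        ≡⟨ cong (_+ x) gapped≡ ⟩
      x + r + SA + SB + x        ≡⟨ back x r SA SB ⟩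
      SA + SB + 2 * x + r        ∎)
      where
      out : ∀ g x r → g + (x + suc r) + r ≡ g + 1 + (r + r) + x
      out = solve-∀
      back : ∀ x r a b → x + r + a + b + x ≡ a + b + 2 * x + r
      back = solve-∀
    δ-gapped : δ G y ≡ δ (SA + SB + 2 * x) (k + y)
    δ-gapped = δ-cong-⇔ {G} {y}
      (λ G≡y → trans (sym G+k≡) (trans (cong (_+ k) G≡y) (+-comm y k)))
      (λ eq  → +-cancelʳ-≡ k _ _ (trans G+k≡ (trans eq (+-comm k y))))

-- Double counting of sets with a chosen run. There are `suc r` runs: the one moved to the front and
-- the `r` that start later in the word.
sumOver-weight : ∀ {n} x w r y → n ≡ x + w + (r + r) →
  suc r * sumOver (subsets (2 + n)) (weight (x + suc r) x y) ≡
  (2 + n) * sumOver (pairsWithSum (+ (x + suc r + y) ℤ.- + (2 * x))) (λ (a , b) → blocks x 0 (suc r) a * blocks w 0 (suc r) b)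
sumOver-weight {n} x w r y n≡ = begin
  suc r * sumOver Ω F
    ≡⟨ sumOver-*ˡ Ω (suc r) F ⟨
  sumOver Ω (λ A → suc r * F A)
    ≡⟨ sumOver-cong Ω (weight-rises x (suc r) y) ⟩
  sumOver Ω (λ A → F A * ∑[ t < 2 + n ] rise A (toℕ t))
    ≡⟨ sumOver-rises n F (weight-rotate (x + suc r) x y) ⟩
  (2 + n) * sumOver (subsets n) (λ u → F (outside ∷ inside ∷ u))
    ≡⟨ cong ((2 + n) *_) (begin
      sumOver (subsets n) (λ u → F (outside ∷ inside ∷ u))
        ≡⟨ sumOver-cong (subsets n) (weight-words x w r y n≡) ⟩
      sumOver (subsets n) (λ u → sumOver ps (λ (a , b) → tally false true x w r a b u))
        ≡⟨ sumOver-comm (subsets n) ps _ ⟩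
      sumOver ps (λ (a , b) → words false true n x w r a b)
        ≡⟨ sumOver-cong ps (λ (a , b) → words-01≡ n x w r a b n≡) ⟩
      sumOver ps (λ (a , b) → blocks x 0 (suc r) a * blocks w 0 (suc r) b) ∎) ⟩
  (2 + n) * sumOver ps (λ (a , b) → blocks x 0 (suc r) a * blocks w 0 (suc r) b) ∎
  where
  open ≡-Reasoning
  Ω  = subsets (2 + n)
  F : Subset (2 + n) → ℕ
  F  = weight (x + suc r) x y
  ps = pairsWithSum (+ (x + suc r + y) ℤ.- + (2 * x))

-- Passage to rational numbers

-- Fractions `_/_` are reduced to lowest terms, so the equation is checked on unnormalised ones,
-- whose equality is cross multiplication.
/-*-/ : ∀ i m j n s t .{{_ : NonZero m}} .{{_ : NonZero n}} .{{_ : NonZero t}} →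
        i ℤ.* j ℤ.* + t ≡ s ℤ.* + (m * n) → (i / m) ℚ.* (j / n) ≡ s / t
/-*-/ i (suc m) j (suc n) s (suc t) eq = ℚ.toℚᵘ-injective (begin
  toℚᵘ ((i / suc m) ℚ.* (j / suc n))
    ≈⟨ ℚ.toℚᵘ-homo-* (i / suc m) (j / suc n) ⟩
  toℚᵘ (i / suc m) ℚᵘ.* toℚᵘ (j / suc n)
    ≈⟨ ℚᵘ.*-cong (ℚ.toℚᵘ-fromℚᵘ (mkℚᵘ i m)) (ℚ.toℚᵘ-fromℚᵘ (mkℚᵘ j n)) ⟩
  mkℚᵘ i m ℚᵘ.* mkℚᵘ j n
    ≈⟨ *≡* eq ⟩
  mkℚᵘ s t
    ≈⟨ ℚ.toℚᵘ-fromℚᵘ (mkℚᵘ s t) ⟨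
  toℚᵘ (s / suc t) ∎)
  where open ℚᵘ.≃-Reasoning

length*uniform : ∀ {a p} {A : Set a} (Ω : List A) {E : Pred A p} (E? : Decidable E) →
                 (+ length Ω / 1) ℚ.* uniform Ω E? ≡ + count E? Ω / 1
-- The default probability is multiplied by the length 0, and the count is 0 too.
length*uniform []        E? = refl
length*uniform Ω@(_ ∷ ω) E? = /-*-/ (+ length Ω) 1 (+ count E? Ω) (length Ω) (+ count E? Ω) 1
  (rearrange (+ length Ω) (+ count E? Ω))
  where
  rearrange : ∀ l c → l ℤ.* c ℤ.* 1ℤ ≡ c ℤ.* (1ℤ ℤ.* l)
  rearrange = ℤ-Solver.solve-∀

summand : ℤ → ℤ → ℤ → ℕ × ℕ → ℕ
summand r t w (a , b) =
  binom r (+ a) * binom t (r ℤ.- + a ℤ.- 1ℤ) * binom r (+ b) * binom w (r ℤ.- + b ℤ.- 1ℤ)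

blocks*blocks≡summand : ∀ x w r a b → blocks x 0 r a * blocks w 0 r b ≡ summand (+ r) (+ x ℤ.- 1ℤ) (+ w ℤ.- 1ℤ) (a , b)
blocks*blocks≡summand x w r a b = trans (cong₂ _*_ (blocks≡binom x r a) (blocks≡binom w r b)) 
  (sym (*-assoc (binom (+ r) (+ a) * binom (+ x ℤ.- 1ℤ) (+ r ℤ.- + a ℤ.- 1ℤ)) (binom (+ r) (+ b)) _))

-- The `n - k` zeros form `k - x` gaps, so this difference is the number of pairs of adjacent zeros.
excess : ∀ n k x → 2 * k ≤ n + x → + n ℤ.- + 2 ℤ.* + k ℤ.+ + x ≡ + (n + x ∸ 2 * k)
excess n k x 2k≤ = begin
  + n ℤ.- + 2 ℤ.* + k ℤ.+ + x   ≡⟨ swap (+ n) (+ 2 ℤ.* + k) (+ x) ⟩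
  + (n + x) ℤ.- + 2 ℤ.* + k     ≡⟨ cong (λ z → + (n + x) ℤ.- z) (ℤ.pos-* 2 k) ⟨
  + (n + x) ℤ.- + (2 * k)       ≡⟨ ℤ.m-n≡m⊖n (n + x) (2 * k) ⟩
  (n + x) ℤ.⊖ (2 * k)           ≡⟨ ℤ.⊖-≥ 2k≤ ⟩
  + (n + x ∸ 2 * k)             ∎
  where
  open ≡-Reasoning
  swap : ∀ n q x → n ℤ.- q ℤ.+ x ≡ n ℤ.+ x ℤ.- q
  swap = ℤ-Solver.solve-∀

runs*count : ∀ n k x y → 2 ≤ n → 2 * k ≤ n → x < k →
  (k ∸ x) * count (λ A → (D 1 A ≟ x) ×-dec (D 2 A ≟ y)) (kSubsets n k) ≡
  n * sumOver (pairsWithSum (+ k ℤ.+ + y ℤ.- + 2 ℤ.* + x))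
        (summand (+ k ℤ.- + x) (+ x ℤ.- 1ℤ) (+ n ℤ.- + 2 ℤ.* + k ℤ.+ + x ℤ.- 1ℤ))
runs*count n@(suc (suc m)) k x y (s≤s (s≤s _)) 2k≤n x<k
  rewrite ℤ.m-n≡m⊖n k x | ℤ.⊖-≥ (<⇒≤ x<k) | excess n k x (m≤n⇒m≤n+o x 2k≤n) | sym (ℤ.pos-* 2 x)
        | count≡weight n k x y = main (k ∸ x) refl
  where
  open ≡-Reasoning
  w = n + x ∸ 2 * k
  -- The number of runs becomes a variable, so that it can be matched as a successor and `k`
  -- replaced by `x + suc r`.
  main : ∀ r → k ∸ x ≡ r → r * sumOver (subsets n) (weight k x y) ≡
         n * sumOver (pairsWithSum (+ (k + y) ℤ.- + (2 * x))) (summand (+ r) (+ x ℤ.- 1ℤ) (+ w ℤ.- 1ℤ))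
  main zero    eq = contradiction x<k (≤⇒≯ (m∸n≡0⇒m≤n eq))
  main (suc r) eq with trans (sym (m+[n∸m]≡n (<⇒≤ x<k))) (cong (_+_ x) eq)
  ... | refl = trans (sumOver-weight x w r y m≡) 
      (cong (n *_) (sumOver-cong (pairsWithSum (+ (x + suc r + y) ℤ.- + (2 * x)))
                     (λ (a , b) → blocks*blocks≡summand x w (suc r) a b)))
    where
    -- The two letters of the rise at the front are not part of the word, so its length is
    -- `m = n - 2`.
    m≡ : m ≡ x + w + (r + r)
    m≡ = +-cancelˡ-≡ (2 + x) _ _ (begin
      2 + x + m                          ≡⟨ cong (λ z → suc (suc z)) (+-comm x m) ⟩
      n + x                              ≡⟨ m∸n+n≡m (m≤n⇒m≤n+o x 2k≤n) ⟨
      w + 2 * (x + suc r)                ≡⟨ rearrange w x r ⟩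
      2 + x + (x + w + (r + r))          ∎)
      where
      rearrange : ∀ w x r → w + 2 * (x + suc r) ≡ 2 + x + (x + w + (r + r))
      rearrange = solve-∀

mainTheorem2 : (n k x y : ℕ) → 4 ≤ n → 1 ≤ k → 2 * k ≤ n → (x<k : x < k) → y ≤ k →
    let Ω  = kSubsets n k
        E? = λ A → (D 1 A ≟ x) ×-dec (D 2 A ≟ y)
        S  = sumOver (pairsWithSum (+ k ℤ.+ + y ℤ.- + 2 ℤ.* + x)) λ (a , b) →
               binom (+ k ℤ.- + x) (+ a) *
               binom (+ x ℤ.- 1ℤ) (+ k ℤ.- + x ℤ.- + a ℤ.- 1ℤ) *
               binom (+ k ℤ.- + x) (+ b) *
               binom (+ n ℤ.- + 2 ℤ.* + k ℤ.+ + x ℤ.- 1ℤ) (+ k ℤ.- + x ℤ.- + b ℤ.- 1ℤ)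
    in
      (+ count E? Ω / 1 ≡ (+ (n C k) / 1) ℚ.* uniform Ω E?)
      × ((+ (n C k) / 1) ℚ.* uniform Ω E? ≡
          _/_ (+ n) (k ∸ x) {{>-nonZero (m<n⇒0<n∸m x<k)}} ℚ.* (+ S / 1))
mainTheorem2 n k x y 4≤n 1≤k 2k≤n x<k y≤k = sym expected , trans expected (sym (/-*-/ (+ n) (k ∸ x) (+ S) 1 (+ N) 1 {{r≢0}} cross))
  where
  open ≡-Reasoning
  r≢0 = >-nonZero (m<n⇒0<n∸m x<k)
  E? = λ A → (D 1 A ≟ x) ×-dec (D 2 A ≟ y)
  N = count E? (kSubsets n k)
  S = sumOver (pairsWithSum (+ k ℤ.+ + y ℤ.- + 2 ℤ.* + x))
        (summand (+ k ℤ.- + x) (+ x ℤ.- 1ℤ) (+ n ℤ.- + 2 ℤ.* + k ℤ.+ + x ℤ.- 1ℤ))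
  -- `n C k` is the size of the sample space and cancels the denominator of the probability.
  expected : (+ (n C k) / 1) ℚ.* uniform (kSubsets n k) E? ≡ + N / 1
  expected = trans (cong (λ c → (+ c / 1) ℚ.* uniform (kSubsets n k) E?) (sym (length-kSubsets n k)))
                   (length*uniform (kSubsets n k) E?)
  cross : + n ℤ.* + S ℤ.* 1ℤ ≡ + N ℤ.* + ((k ∸ x) * 1)
  cross = begin
    + n ℤ.* + S ℤ.* 1ℤ        ≡⟨ ℤ.*-identityʳ (+ n ℤ.* + S) ⟩
    + n ℤ.* + S               ≡⟨ ℤ.pos-* n S ⟨
    + (n * S)                 ≡⟨ cong +_ (runs*count n k x y (≤-trans (s≤s (s≤s z≤n)) 4≤n) 2k≤n x<k) ⟨
    + ((k ∸ x) * N)           ≡⟨ cong +_ (trans (*-comm (k ∸ x) N) (cong (N *_) (sym (*-identityʳ (k ∸ x))))) ⟩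
    + (N * ((k ∸ x) * 1))     ≡⟨ ℤ.pos-* N ((k ∸ x) * 1) ⟩
    + N ℤ.* + ((k ∸ x) * 1)   ∎
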